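{- Let $r$ and $t$ be integers with $\frac{r}{4} < t \leq r-1$. If $\mathcal{H}$ is an $r$-uniform $r$-partite $t$-intersecting hypergraph, then $\tau(\mathcal{H}) \leq r-t$.
   Context: A hypergraph $\mathcal{H}=(V,E)$ has a finite vertex set $V$ and a multiset $E$ of subsets of $V$ (hyperedges). It is $r$-uniform if every hyperedge has exactly $r$ vertices; $r$-partite if $V$ has a partition into $r$ nonempty classes such that no hyperedge contains two vertices of the same class; $t$-intersecting if every two hyperedges share at least $t$ vertices. The vertex covering number is $\tau(\mathcal{H})=\min\{|T| : T\subseteq V,\ T\cap f\neq\emptyset \text{ for all } f\in E\}$. -}

module Defs where

open import Data.Nat using (ℕ; _≤_; _<_; _*_; _∸_)
open import Data.Fin using (Fin)
open import Data.Fin.Subset using (Subset; _∈_; _∩_; ∣_∣)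
open import Data.List using (List)
open import Data.List.Relation.Unary.Any using (Any)
open import Data.List.Relation.Unary.All using (All)
open import Data.Product using (∃; _×_)
open import Relation.Binary.PropositionalEquality using (_≡_)
open import Relation.Nullary using (¬_)
open import Data.List.Membership.Propositional renaming (_∈_ to _∈ₗ_)

record Hypergraph : Set where
  field
    n     : ℕ
    edges : List (Subset n)
open Hypergraph public

-- hyperedge positions (so multiset repetitions are distinct indices)
Edge : Hypergraph → Set
Edge H = Data.Fin.Fin (Data.List.length (edges H))

edge : (H : Hypergraph) → Edge H → Subset (n H)
edge H i = Data.List.lookup (edges H) i

Uniform : ℕ → Hypergraph → Set
Uniform r H = ∀ i → ∣ edge H i ∣ ≡ r

Partite : ℕ → Hypergraph → Set
Partite r H = ∃ λ (cls : Fin (n H) → Fin r) →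
  (∀ c → ∃ λ v → cls v ≡ c) ×
  (∀ i u v → u ∈ edge H i → v ∈ edge H i → cls u ≡ cls v → u ≡ v)

Intersecting : ℕ → Hypergraph → Set
Intersecting t H = ∀ i j → ¬ i ≡ j → t ≤ ∣ edge H i ∩ edge H j ∣

IsCover : (H : Hypergraph) → Subset (n H) → Set
IsCover H T = ∀ i → ∃ λ v → v ∈ T × v ∈ edge H i

-- τ(H) ≤ k: the minimum cover size is at most k, i.e. some cover has size ≤ k
τ≤ : Hypergraph → ℕ → Set
τ≤ H k = ∃ λ T → IsCover H T × ∣ T ∣ ≤ k

-- Suppose no r − t vertices cover H, so every set T of at most r − t vertices is missed by some
-- edge h.  An edge meets each class once, so it is a word with r letters; any two words agree in
-- at least t columns.  If e ≠ f agree in a columns, choose T ⊆ e ∪ f so that it blocks the common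
-- vertices first and then both vertices of as many other columns as the budget allows: counting
-- the agreements of h with e and f leaves only a = t and r = 4t − 1.  Given e and a t-set S of
-- columns, T = e off S yields an edge agreeing with e exactly on S.  For t ≥ 2, do this for two
-- t-sets sharing t − 1 columns; the resulting f, g and e agree in a common set of x = t − 1
-- columns, and blocking the values shared by two of them, plus both values where e = f ≠ g, costs
-- 4t − 3x ≤ r − t and forces 4t ≤ r.  For t = 1 and r = 3 a direct chase remains.
module Submission where

open import Defs
open import Data.Nat using (ℕ; _≤_; _<_; _*_; _∸_)
open import Data.Nat using (zero; suc; _+_; _≤?_; z≤n; s≤s)
open import Data.Bool using (Bool; true; false; T; if_then_else_; not; _∧_)
open import Data.Empty as Empty using (⊥-elim)
open import Data.Fin using (Fin; zero; suc; _≟_)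
open import Data.Fin.Patterns using (0F; 1F; 2F)
open import Data.Fin.Properties using (any?; all?; ¬∀⟶∃¬)
open import Data.Fin.Subset using (Subset; inside; outside; _∈_; _∩_; _∪_; ⋃; ⁅_⁆; ∣_∣; ⊥)
open import Data.Fin.Subset.Properties
  using (_∈?_; ∣⊥∣≡0; ∣⁅x⁆∣≡1; x∈⁅x⁆; x∈p∪q⁺; x∈p∩q⁻; p⊆q⇒∣p∣≤∣q∣; ∩-idem; anySubset?)
open import Data.List as List using (List; []; _∷_; length)
open import Data.List.Membership.Propositional using (_∉_) renaming (_∈_ to _∈ₗ_)
open import Data.List.Membership.Propositional.Properties using (∈-concat⁺′; ∈-tabulate⁺)
open import Data.List.Properties using (length-++)
open import Data.List.Relation.Unary.Any using (here; there)
open import Data.Nat.Properties hiding (_≟_; _≤?_)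
open import Data.Nat.Solver using (module +-*-Solver)
open import Data.Product using (∃; _×_; _,_; proj₁; proj₂)
open import Data.Sum using (inj₁; inj₂)
open import Data.Unit using (tt)
open import Data.Vec using ([]; _∷_)
import Data.Vec.Functional as Vector
open import Function using (_∘_)
open import Relation.Binary.Definitions using (DecidableEquality)
open import Relation.Binary.PropositionalEquality
open import Relation.Nullary using (Dec; does; yes; no; ¬_; contradiction)
open import Relation.Nullary.Decidable using (_×-dec_; decidable-stable)
open import Algebra.Properties.CommutativeMonoid.Sum +-0-commutativeMonoid
  using (sum; ∑-distrib-+; sum-cong-≗)
open +-*-Solver using (solve; _:+_; _:*_; _:=_; con)

private variable
  r : ℕ

-- Sums over columns.

sum-mono-≤ : {f g : Fin r → ℕ} → (∀ c → f c ≤ g c) → sum f ≤ sum g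
sum-mono-≤ {zero}  f≤g = z≤n
sum-mono-≤ {suc r} f≤g = +-mono-≤ (f≤g zero) (sum-mono-≤ (f≤g ∘ suc))

sum-1 : ∀ r → sum {r} (λ _ → 1) ≡ r
sum-1 zero    = refl
sum-1 (suc r) = cong suc (sum-1 r)

sum-≡0 : {f : Fin r → ℕ} → (∀ c → f c ≡ 0) → sum f ≡ 0
sum-≡0 {zero}  f≡0 = refl
sum-≡0 {suc r} f≡0 = cong₂ _+_ (f≡0 zero) (sum-≡0 (f≡0 ∘ suc))

-- A strict gap in one column could not be made up in the others. This turns a bound on totals into
-- exact information about every column.
sum-mono-≤-tight : {f g : Fin r → ℕ} → (∀ c → f c ≤ g c) → sum g ≤ sum f → ∀ c → g c ≤ f c
sum-mono-≤-tight {suc r} {f} {g} f≤g g≤f zero =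
  +-cancelʳ-≤ _ (g zero) (f zero)
    (≤-trans g≤f (+-monoʳ-≤ (f zero) (sum-mono-≤ (f≤g ∘ suc))))
sum-mono-≤-tight {suc r} {f} {g} f≤g g≤f (suc c) =
  sum-mono-≤-tight (f≤g ∘ suc)
    (+-cancelˡ-≤ (f zero) _ _ (≤-trans (+-monoˡ-≤ _ (f≤g zero)) g≤f)) c

∑-distrib₃ : (f g h : Fin r → ℕ) → sum (λ c → f c + g c + h c) ≡ sum f + sum g + sum h
∑-distrib₃ f g h = trans (∑-distrib-+ (λ c → f c + g c) h) (cong (_+ sum h) (∑-distrib-+ f g))

∑-distrib₄ : (f g h k : Fin r → ℕ) →
             sum (λ c → f c + g c + h c + k c) ≡ sum f + sum g + sum h + sum k
∑-distrib₄ f g h k =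
  trans (∑-distrib-+ (λ c → f c + g c + h c) k) (cong (_+ sum k) (∑-distrib₃ f g h))

-- `b` is half of `n` rounded down: the number of columns in which a budget of `n` can block two
-- vertices each.
halve : ∀ n → ∃ λ b → b + b ≤ n × n ≤ suc (b + b)
halve 0 = 0 , z≤n , z≤n
halve 1 = 0 , z≤n , s≤s z≤n
halve (suc (suc n)) =
  let b , 2b≤n , n≤2b+1 = halve n in
  suc b , s≤s (subst (_≤ suc n) (sym (+-suc b b)) (s≤s 2b≤n)) ,
  s≤s (s≤s (subst (n ≤_) (sym (+-suc b b)) n≤2b+1))

-- Sets of columns and their sizes.

⟦_⟧ : Bool → ℕ
⟦ true  ⟧ = 1
⟦ false ⟧ = 0

count : (Fin r → Bool) → ℕ
count P = sum (λ c → ⟦ P c ⟧)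

select : (P : Fin r → Bool) (k : ℕ) → k ≤ count P →
         ∃ λ Q → (∀ c → T (Q c) → T (P c)) × count Q ≡ k
select {zero}  P zero    k≤ = P , (λ _ p → p) , refl
select {suc r} P zero    k≤ = (λ _ → false) , (λ _ ()) , sum-≡0 {suc r} (λ _ → refl)
select {suc r} P (suc k) k≤ with P zero in eq
... | false = let Q , Q⊆P , |Q| = select (P ∘ suc) (suc k) k≤ in
  false Vector.∷ Q , (λ { (suc c) → Q⊆P c }) , |Q|
... | true  = let Q , Q⊆P , |Q| = select (P ∘ suc) k (≤-pred k≤) in
  true Vector.∷ Q ,
  (λ { zero _ → subst T (sym eq) tt ; (suc c) → Q⊆P c }) , cong suc |Q|

count-positive : (P : Fin r → Bool) → 1 ≤ count P → ∃ λ c → T (P c)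
count-positive {suc r} P 1≤ with P zero in eq
... | true  = zero , subst T (sym eq) tt
... | false = let c , p = count-positive (P ∘ suc) 1≤ in suc c , p

count-complement : (P : Fin r → Bool) → count P + count (not ∘ P) ≡ r
count-complement {r} P = trans (sym (∑-distrib-+ (λ c → ⟦ P c ⟧) (λ c → ⟦ not (P c) ⟧)))
  (trans (sum-cong-≗ (λ c → split (P c))) (sum-1 r))
  where
  split : ∀ b → ⟦ b ⟧ + ⟦ not b ⟧ ≡ 1
  split true  = refl
  split false = refl

-- Start from the singletons of the first two columns and prepend a shared column at each step.
almost-equal-sets : ∀ k → suc (suc k) ≤ r → ∃ λ (S : Fin r → Bool) → ∃ λ S′ →
  count S ≡ suc k × count S′ ≡ suc k × count (λ c → S c ∧ S′ c) ≡ k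
almost-equal-sets {suc (suc r)} zero    (s≤s (s≤s z≤n)) =
  true Vector.∷ (λ _ → false) , false Vector.∷ true Vector.∷ (λ _ → false) ,
  cong suc (sum-≡0 {suc r} (λ _ → refl)) , cong suc (sum-≡0 {r} (λ _ → refl)) ,
  sum-≡0 {r} (λ _ → refl)
almost-equal-sets {suc r} (suc k) (s≤s k<r) =
  let S , S′ , |S| , |S′| , |S∩S′| = almost-equal-sets k k<r in
  true Vector.∷ S , true Vector.∷ S′ , cong suc |S| , cong suc |S′| , cong suc |S∩S′|

⟦⟧-antisym : ∀ {a b} → ⟦ a ⟧ ≤ ⟦ b ⟧ → ⟦ b ⟧ ≤ ⟦ a ⟧ → a ≡ b
⟦⟧-antisym {true}  {true}  _  _  = refl
⟦⟧-antisym {true}  {false} () _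
⟦⟧-antisym {false} {true}  _  ()
⟦⟧-antisym {false} {false} _  _  = refl

-- The case of three columns.

-- Up to renaming vertices the chase finds e = 000, f = 011, g = 210, h = 201; a word k avoiding
-- both 0 and 2 in the first column cannot meet all four.
three-columns : {V E : Set} (w : E → Fin 3 → V) → (∀ i j → ∃ λ c → w i c ≡ w j c) →
                (∀ (L : Fin 3 → List V) → sum (length ∘ L) ≤ 2 → ∃ λ i → ∀ c → w i c ∉ L c) →
                ¬ E
three-columns {V} {E} w inter miss e = conclude (inter e k)
  where
  miss′ : (A B C : List V) → length A + (length B + (length C + 0)) ≤ 2 →
          ∃ λ i → ∀ c → w i c ∉ (A Vector.∷ B Vector.∷ C Vector.∷ Vector.[]) c
  miss′ A B C = miss (A Vector.∷ B Vector.∷ C Vector.∷ Vector.[])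

  disjoint : ∀ i j → w i 0F ≢ w j 0F → w i 1F ≢ w j 1F → ¬ w i 2F ≢ w j 2F
  disjoint i j ≢₀ ≢₁ ≢₂ with inter i j
  ... | 0F , eq = ≢₀ eq
  ... | 1F , eq = ≢₁ eq
  ... | 2F , eq = ≢₂ eq

  meet₀ : ∀ i j → w i 1F ≢ w j 1F → w i 2F ≢ w j 2F → w i 0F ≡ w j 0F
  meet₀ i j ≢₁ ≢₂ with inter i j
  ... | 0F , eq = eq
  ... | 1F , eq = contradiction eq ≢₁
  ... | 2F , eq = contradiction eq ≢₂

  meet₁ : ∀ i j → w i 0F ≢ w j 0F → w i 2F ≢ w j 2F → w i 1F ≡ w j 1F
  meet₁ i j ≢₀ ≢₂ with inter i j
  ... | 0F , eq = contradiction eq ≢₀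
  ... | 1F , eq = eq
  ... | 2F , eq = contradiction eq ≢₂

  meet₂ : ∀ i j → w i 0F ≢ w j 0F → w i 1F ≢ w j 1F → w i 2F ≡ w j 2F
  meet₂ i j ≢₀ ≢₁ with inter i j
  ... | 0F , eq = contradiction eq ≢₀
  ... | 1F , eq = contradiction eq ≢₁
  ... | 2F , eq = eq

  f-missed = miss′ [] (w e 1F ∷ []) (w e 2F ∷ []) ≤-refl
  f = proj₁ f-missed

  e₁≢f₁ : w e 1F ≢ w f 1F
  e₁≢f₁ = proj₂ f-missed 1F ∘ here ∘ sym

  e₂≢f₂ : w e 2F ≢ w f 2F
  e₂≢f₂ = proj₂ f-missed 2F ∘ here ∘ sym

  e₀≡f₀ : w e 0F ≡ w f 0F
  e₀≡f₀ = meet₀ e f e₁≢f₁ e₂≢f₂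

  g-missed = miss′ (w e 0F ∷ []) (w e 1F ∷ []) [] ≤-refl
  g = proj₁ g-missed

  e₀≢g₀ : w e 0F ≢ w g 0F
  e₀≢g₀ = proj₂ g-missed 0F ∘ here ∘ sym

  e₂≡g₂ : w e 2F ≡ w g 2F
  e₂≡g₂ = meet₂ e g e₀≢g₀ (proj₂ g-missed 1F ∘ here ∘ sym)

  f₁≡g₁ : w f 1F ≡ w g 1F
  f₁≡g₁ = meet₁ f g (e₀≢g₀ ∘ trans e₀≡f₀) (λ eq → e₂≢f₂ (trans e₂≡g₂ (sym eq)))

  -- `f` and `g` share the vertex blocked in column 1, so `h` must meet `f` in column 2 and `e` in
  -- column 1, which leaves only column 0 for `g`.
  h-missed = miss′ (w e 0F ∷ []) (w f 1F ∷ []) [] ≤-refl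
  h = proj₁ h-missed

  e₀≢h₀ : w e 0F ≢ w h 0F
  e₀≢h₀ = proj₂ h-missed 0F ∘ here ∘ sym

  f₁≢h₁ : w f 1F ≢ w h 1F
  f₁≢h₁ = proj₂ h-missed 1F ∘ here ∘ sym

  f₂≡h₂ : w f 2F ≡ w h 2F
  f₂≡h₂ = meet₂ f h (e₀≢h₀ ∘ trans e₀≡f₀) f₁≢h₁

  e₁≡h₁ : w e 1F ≡ w h 1F
  e₁≡h₁ = meet₁ e h e₀≢h₀ (λ eq → e₂≢f₂ (trans eq (sym f₂≡h₂)))

  g₀≡h₀ : w g 0F ≡ w h 0F
  g₀≡h₀ = meet₀ g h (f₁≢h₁ ∘ trans f₁≡g₁) (λ eq → e₂≢f₂ (trans e₂≡g₂ (trans eq (sym f₂≡h₂))))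

  k-missed = miss′ (w e 0F ∷ w g 0F ∷ []) [] [] ≤-refl
  k = proj₁ k-missed

  e₀≢k₀ : w e 0F ≢ w k 0F
  e₀≢k₀ = proj₂ k-missed 0F ∘ here ∘ sym

  g₀≢k₀ : w g 0F ≢ w k 0F
  g₀≢k₀ = proj₂ k-missed 0F ∘ there ∘ here ∘ sym

  conclude : ¬ (∃ λ c → w e c ≡ w k c)
  conclude (0F , e₀≡k₀) = e₀≢k₀ e₀≡k₀
  -- Now `k` can meet `f` only in column 2, so it reads ?01 and is disjoint from `g` = 210.
  conclude (1F , e₁≡k₁) = disjoint g k g₀≢k₀
    (λ g₁≡k₁ → f₁≢k₁ (trans f₁≡g₁ g₁≡k₁))
    (λ g₂≡k₂ → e₂≢f₂ (trans e₂≡g₂ (trans g₂≡k₂ (sym f₂≡k₂))))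
    where
    f₁≢k₁ : w f 1F ≢ w k 1F
    f₁≢k₁ f₁≡k₁ = e₁≢f₁ (trans e₁≡k₁ (sym f₁≡k₁))
    f₂≡k₂ : w f 2F ≡ w k 2F
    f₂≡k₂ = meet₂ f k (e₀≢k₀ ∘ trans e₀≡f₀) f₁≢k₁
  -- Now `k` can meet `f` only in column 1, so it reads ?10 and is disjoint from `h` = 201.
  conclude (2F , e₂≡k₂) = disjoint h k (g₀≢k₀ ∘ trans g₀≡h₀)
    (λ h₁≡k₁ → e₁≢f₁ (trans e₁≡h₁ (trans h₁≡k₁ (sym f₁≡k₁))))
    (λ h₂≡k₂ → f₂≢k₂ (trans f₂≡h₂ h₂≡k₂))
    where
    f₂≢k₂ : w f 2F ≢ w k 2F
    f₂≢k₂ f₂≡k₂ = e₂≢f₂ (trans e₂≡k₂ (sym f₂≡k₂))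
    f₁≡k₁ : w f 1F ≡ w k 1F
    f₁≡k₁ = meet₁ f k (e₀≢k₀ ∘ trans e₀≡f₀) f₂≢k₂

-- Words and the columns in which they agree.

module Words {V E : Set} (_≈?_ : DecidableEquality V) (w : E → Fin r → V) where

  same : E → E → Fin r → Bool
  same i j c = does (w i c ≈? w j c)

  same⇒≡ : ∀ i j c → T (same i j c) → w i c ≡ w j c
  same⇒≡ i j c _ with yes eq ← w i c ≈? w j c = eq

  agr : E → E → ℕ
  agr i j = count (same i j)

  -- `miss` is the absence of a small cover in positive form: blocked vertices are listed column by
  -- column, and some word avoids them all. Writing the budget as a sum avoids truncated
  -- subtraction.
  module NoCover (t : ℕ) (r<4t : r < 4 * t) (t<r : t < r)
    (inter : ∀ i j → t ≤ agr i j)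
    (miss : ∀ (L : Fin r → List V) → sum (length ∘ L) + t ≤ r →
            ∃ λ i → ∀ c → w i c ∉ L c)
    where

    -- Spend the whole budget on a set `U` of `r ∸ t` common columns. The missed word `h` must agree
    -- with `e` and with `f` in `t` columns each, and only the `t` columns off `U` remain; so it
    -- agrees with both in all of them, and `e`, `f` agree everywhere. The proof sums this column by
    -- column.
    agr-large : ∀ e f → r ≤ t + agr e f → r ≤ agr e f
    agr-large e f r≤t+a
      with select (same e f) (r ∸ t) (m≤n+o⇒m∸n≤o r t r≤t+a)
    ... | U , U⊆ , |U| = let h , h∉ = miss L (≤-reflexive |L|+t) in conclude h h∉
      where
      L : Fin r → List V
      L c = if U c then w e c ∷ [] else []

      length-L : ∀ c → length (L c) ≡ ⟦ U c ⟧
      length-L c with U c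
      ... | true  = refl
      ... | false = refl

      |L|+t : sum (length ∘ L) + t ≡ r
      |L|+t = trans (cong (_+ t) (trans (sum-cong-≗ length-L) |U|)) (m∸n+n≡m (<⇒≤ t<r))

      conclude : ∀ h → (∀ c → w h c ∉ L c) → r ≤ agr e f
      conclude h h∉ = +-cancelˡ-≤ r _ _ (begin
        r + r                               ≡⟨ cong₂ _+_ (sym |L|+t) (sym |L|+t) ⟩
        (l + t) + (l + t)                   ≡⟨ solve 2 (λ l t → (l :+ t) :+ (l :+ t) := t :+ t :+ (l :+ l)) refl l t ⟩
        t + t + (l + l)                     ≤⟨ +-monoˡ-≤ (l + l) (+-mono-≤ (inter h e) (inter h f)) ⟩
        agr h e + agr h f + (l + l)         ≡⟨ cong (agr h e + agr h f +_) (sym (∑-distrib-+ (length ∘ L) (length ∘ L))) ⟩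
        agr h e + agr h f + sum (λ c → length (L c) + length (L c))
          ≡⟨ sym (∑-distrib₃ _ _ (λ c → length (L c) + length (L c))) ⟩
        _                                   ≤⟨ sum-mono-≤ pointwise ⟩
        sum (λ c → 1 + ⟦ same e f c ⟧)      ≡⟨ trans (∑-distrib-+ (λ _ → 1) (λ c → ⟦ same e f c ⟧)) (cong (_+ agr e f) (sum-1 r)) ⟩
        r + agr e f                         ∎)
        where
        open ≤-Reasoning
        l : ℕ
        l = sum (length ∘ L)

        pointwise : ∀ c → ⟦ same h e c ⟧ + ⟦ same h f c ⟧ + (length (L c) + length (L c))
                        ≤ 1 + ⟦ same e f c ⟧
        pointwise c with w e c ≈? w f c | U c | U⊆ c | h∉ c | w h c ≈? w e c | w h c ≈? w f c
        ... | yes _   | true  | _   | h∉ | yes h≡e | _       = contradiction (here h≡e) h∉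
        ... | yes e≡f | true  | _   | _  | no  h≢e | yes h≡f = contradiction (trans h≡f (sym e≡f)) h≢e
        ... | yes _   | true  | _   | _  | no  _   | no  _   = ≤-refl
        ... | no  _   | true  | e≡f | _  | _       | _       = ⊥-elim (e≡f tt)
        ... | no  e≢f | false | _   | _  | yes h≡e | yes h≡f = contradiction (trans (sym h≡e) h≡f) e≢f
        ... | yes _   | false | _   | _  | yes _   | yes _   = ≤-refl
        ... | yes _   | false | _   | _  | yes _   | no  _   = s≤s z≤n
        ... | no  _   | false | _   | _  | yes _   | no  _   = ≤-refl
        ... | yes _   | false | _   | _  | no  _   | yes _   = s≤s z≤n
        ... | no  _   | false | _   | _  | no  _   | yes _   = ≤-refl
        ... | _       | false | _   | _  | no  _   | no  _   = z≤n

    -- Block every common vertex, then both vertices in `b` further columns. A column now holds at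
    -- most one of: an agreement of `h` with `e`, one of `h` with `f`, a common vertex, membership
    -- in `B`. Summing gives `t + t + a + b ≤ r`, and the choice of `b` makes this nearly
    -- impossible.
    agr-small : ∀ e f → t + agr e f ≤ r → agr e f ≡ t × suc r ≡ 4 * t
    agr-small e f t+a≤r
      with halve (r ∸ (t + agr e f))
    ... | b , 2b≤ , ≤2b+1
      -- There is room for `b` columns: `b` is at most `r ∸ (t + a)`, hence at most `r ∸ a`, the
      -- number of columns where `e` and `f` differ.
      with select (not ∘ same e f) b (≤-trans (m+n≤o⇒m≤o b 2b≤) (≤-trans (∸-monoʳ-≤ r (m≤n+m (agr e f) t))
        (m≤n+o⇒m∸n≤o r (agr e f) (≤-reflexive (sym (count-complement (same e f)))))))
    ... | B , B⊆ , |B| = let h , h∉ = miss L |L|+t in conclude h h∉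
      where
      open ≤-Reasoning
      a : ℕ
      a = agr e f

      L : Fin r → List V
      L c = if same e f c then w e c ∷ [] else if B c then w e c ∷ w f c ∷ [] else []

      length-L : ∀ c → length (L c) ≤ ⟦ same e f c ⟧ + (⟦ B c ⟧ + ⟦ B c ⟧)
      length-L c with same e f c | B c
      ... | true  | _     = s≤s z≤n
      ... | false | true  = ≤-refl
      ... | false | false = ≤-refl

      |L|+t : sum (length ∘ L) + t ≤ r
      |L|+t = begin
        sum (length ∘ L) + t   ≤⟨ +-monoˡ-≤ t (sum-mono-≤ length-L) ⟩
        sum (λ c → ⟦ same e f c ⟧ + (⟦ B c ⟧ + ⟦ B c ⟧)) + t
          ≡⟨ cong (_+ t) (trans (∑-distrib-+ _ (λ c → ⟦ B c ⟧ + ⟦ B c ⟧))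
               (cong (a +_) (trans (∑-distrib-+ (λ c → ⟦ B c ⟧) _) (cong₂ _+_ |B| |B|)))) ⟩
        a + (b + b) + t        ≡⟨ solve 3 (λ a b t → a :+ (b :+ b) :+ t := b :+ b :+ (t :+ a)) refl a b t ⟩
        b + b + (t + a)        ≤⟨ +-monoˡ-≤ (t + a) 2b≤ ⟩
        r ∸ (t + a) + (t + a)  ≡⟨ m∸n+n≡m t+a≤r ⟩
        r                      ∎

      conclude : ∀ h → (∀ c → w h c ∉ L c) → a ≡ t × suc r ≡ 4 * t
      conclude h h∉ = a≡t , ≤-antisym r<4t 4t≤
        where
        pointwise : ∀ c → ⟦ same h e c ⟧ + ⟦ same h f c ⟧ + ⟦ same e f c ⟧ + ⟦ B c ⟧ ≤ 1
        pointwise c with w e c ≈? w f c | B c | B⊆ c | h∉ c | w h c ≈? w e c | w h c ≈? w f c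
        ... | yes _   | true  | e≢f | _  | _       | _       = ⊥-elim (e≢f tt)
        ... | yes _   | false | _   | h∉ | yes h≡e | _       = contradiction (here h≡e) h∉
        ... | yes e≡f | false | _   | h∉ | no  h≢e | yes h≡f = contradiction (trans h≡f (sym e≡f)) h≢e
        ... | yes _   | false | _   | _  | no  _   | no  _   = ≤-refl
        ... | no  _   | true  | _   | h∉ | yes h≡e | _       = contradiction (here h≡e) h∉
        ... | no  _   | true  | _   | h∉ | no  _   | yes h≡f = contradiction (there (here h≡f)) h∉
        ... | no  _   | true  | _   | _  | no  _   | no  _   = ≤-refl
        ... | no  e≢f | false | _   | _  | yes h≡e | yes h≡f = contradiction (trans (sym h≡e) h≡f) e≢f
        ... | no  _   | false | _   | _  | yes _   | no  _   = ≤-refl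
        ... | no  _   | false | _   | _  | no  _   | yes _   = ≤-refl
        ... | no  _   | false | _   | _  | no  _   | no  _   = z≤n

        2t+a+b≤r : t + t + a + b ≤ r
        2t+a+b≤r = begin
          t + t + a + b                   ≤⟨ +-monoˡ-≤ b (+-monoˡ-≤ a (+-mono-≤ (inter h e) (inter h f))) ⟩
          agr h e + agr h f + a + b       ≡⟨ cong (agr h e + agr h f + a +_) (sym |B|) ⟩
          agr h e + agr h f + a + count B ≡⟨ sym (∑-distrib₄ _ _ _ (λ c → ⟦ B c ⟧)) ⟩
          _                               ≤⟨ sum-mono-≤ pointwise ⟩
          sum {r} (λ _ → 1)               ≡⟨ sum-1 r ⟩
          r                               ∎

        r≤ : r ≤ suc (b + b) + (t + a)
        r≤ = ≤-trans (≤-reflexive (sym (m∸n+n≡m t+a≤r))) (+-monoˡ-≤ (t + a) ≤2b+1)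

        3t+a≤r+1 : t + t + t + a ≤ suc r
        -- Doubling the estimate eliminates `b`. The unit lost in rounding the half down is what
        -- lets the case `suc r ≡ 4 * t` survive.
        3t+a≤r+1 = +-cancelʳ-≤ (r + (b + b + (t + a))) _ _ (begin
          t + t + t + a + (r + (b + b + (t + a)))
            ≡⟨ solve 4 (λ t a r b → t :+ t :+ t :+ a :+ (r :+ (b :+ b :+ (t :+ a)))
                                 := (t :+ t :+ a :+ b) :+ (t :+ t :+ a :+ b) :+ r) refl t a r b ⟩
          (t + t + a + b) + (t + t + a + b) + r
            ≤⟨ +-mono-≤ (+-mono-≤ 2t+a+b≤r 2t+a+b≤r) r≤ ⟩
          r + r + (suc (b + b) + (t + a))
            ≡⟨ solve 3 (λ r b s → r :+ r :+ (con 1 :+ (b :+ b) :+ s)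
                               := con 1 :+ r :+ (r :+ (b :+ b :+ s))) refl r b (t + a) ⟩
          suc r + (r + (b + b + (t + a)))  ∎)

        a≡t : a ≡ t
        a≡t = ≤-antisym (+-cancelˡ-≤ (t + t + t) a t (begin
          t + t + t + a ≤⟨ 3t+a≤r+1 ⟩
          suc r         ≤⟨ r<4t ⟩
          4 * t         ≡⟨ solve 1 (λ t → con 4 :* t := t :+ t :+ t :+ t) refl t ⟩
          t + t + t + t ∎)) (inter e f)

        4t≤ : 4 * t ≤ suc r
        4t≤ = begin
          4 * t         ≡⟨ solve 1 (λ t → con 4 :* t := t :+ t :+ t :+ t) refl t ⟩
          t + t + t + t ≡⟨ cong (t + t + t +_) (sym a≡t) ⟩
          t + t + t + a ≤⟨ 3t+a≤r+1 ⟩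
          suc r         ∎

    agr-dichotomy : ∀ e f → agr e f < r → agr e f ≡ t × suc r ≡ 4 * t
    agr-dichotomy e f a<r with ≤-total (t + agr e f) r
    ... | inj₁ t+a≤r = agr-small e f t+a≤r
    ... | inj₂ r≤t+a = contradiction (agr-large e f r≤t+a) (<⇒≱ a<r)

    -- Block `e` off `S`, at cost `r ∸ t`. The missed word agrees with `e` only inside `S`, yet in
    -- at least `t` columns, so it agrees on all of `S`.
    realise : ∀ e (S : Fin r → Bool) → count S ≡ t → ∃ λ g → ∀ c → same e g c ≡ S c
    realise e S |S| = let g , g∉ = miss L (≤-reflexive |L|+t) in g , agrees g g∉
      where
      L : Fin r → List V
      L c = if S c then [] else w e c ∷ []

      length-L : ∀ c → length (L c) ≡ ⟦ not (S c) ⟧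
      length-L c with S c
      ... | true  = refl
      ... | false = refl

      |L|+t : sum (length ∘ L) + t ≡ r
      |L|+t = trans (cong₂ _+_ (sum-cong-≗ length-L) (sym |S|))
                    (trans (+-comm (count (not ∘ S)) (count S)) (count-complement S))

      agrees : ∀ g → (∀ c → w g c ∉ L c) → ∀ c → same e g c ≡ S c
      agrees g g∉ c = ⟦⟧-antisym (below c) (sum-mono-≤-tight below
                        (≤-trans (≤-reflexive |S|) (inter e g)) c)
        where
        below : ∀ c → ⟦ same e g c ⟧ ≤ ⟦ S c ⟧
        below c with S c | g∉ c | w e c ≈? w g c
        ... | true  | _  | yes _   = ≤-refl
        ... | true  | _  | no  _   = z≤n
        ... | false | g∉ | yes e≡g = contradiction (here (sym e≡g)) g∉
        ... | false | _  | no  _   = z≤n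

    -- `L` blocks each value shared by two of the words, and also that of `g` where `e` and `f`
    -- agree without it. The cost is at most `4 * t` minus `3x`, within `r ∸ t` once
    -- `t < x + x + x`. The missed word then forces `4 * t ≤ r`.
    ¬large-triple : ∀ e f g → agr e f ≡ t → agr e g ≡ t → agr f g ≡ t → suc r ≡ 4 * t →
             let x = count (λ c → same e f c ∧ same e g c) in
             ¬ t < x + x + x
    ¬large-triple e f g ef eg fg r+1≡4t t<3x = let h , h∉ = miss L |L|+t in conclude h h∉
      where
      open ≤-Reasoning
      X : Fin r → Bool
      X c = same e f c ∧ same e g c

      x : ℕ
      x = count X

      L : Fin r → List V
      L c = if same e f c
              then (if same e g c then w e c ∷ [] else w e c ∷ w g c ∷ [])
              else (if same e g c then w e c ∷ [] else if same f g c then w f c ∷ [] else [])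

      -- `same e f` is counted twice because a column where `e`, `f` agree without `g` costs two. A
      -- column common to all three is then counted four times but costs one, hence the three copies
      -- of `X`.
      length-L : ∀ c → length (L c) + ⟦ X c ⟧ + ⟦ X c ⟧ + ⟦ X c ⟧
                     ≤ ⟦ same e f c ⟧ + ⟦ same e f c ⟧ + ⟦ same e g c ⟧ + ⟦ same f g c ⟧
      length-L c with w e c ≈? w f c | w e c ≈? w g c | w f c ≈? w g c
      ... | yes _   | yes _   | yes _   = ≤-refl
      ... | yes e≡f | yes e≡g | no  f≢g = contradiction (trans (sym e≡f) e≡g) f≢g
      ... | yes _   | no  _   | yes _   = s≤s (s≤s z≤n)
      ... | yes _   | no  _   | no  _   = ≤-refl
      ... | no  _   | yes _   | yes _   = s≤s z≤n
      ... | no  _   | yes _   | no  _   = ≤-refl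
      ... | no  _   | no  _   | yes _   = ≤-refl
      ... | no  _   | no  _   | no  _   = ≤-refl

      l : ℕ
      l = sum (length ∘ L)

      |L|+3x≤4t : l + x + x + x ≤ 4 * t
      |L|+3x≤4t = begin
        l + x + x + x                         ≡⟨ sym (∑-distrib₄ (length ∘ L) _ _ _) ⟩
        _                                     ≤⟨ sum-mono-≤ length-L ⟩
        _                                     ≡⟨ ∑-distrib₄ _ _ _ (λ c → ⟦ same f g c ⟧) ⟩
        agr e f + agr e f + agr e g + agr f g ≡⟨ cong₂ _+_ (cong₂ _+_ (cong₂ _+_ ef ef) eg) fg ⟩
        t + t + t + t                         ≡⟨ solve 1 (λ t → t :+ t :+ t :+ t := con 4 :* t) refl t ⟩
        4 * t                                 ∎

      |L|+t : l + t ≤ r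
      |L|+t = ≤-pred (begin
        suc (l + t)       ≡⟨ sym (+-suc l t) ⟩
        l + suc t         ≤⟨ +-monoʳ-≤ l t<3x ⟩
        l + (x + x + x)   ≡⟨ solve 2 (λ l x → l :+ (x :+ x :+ x) := l :+ x :+ x :+ x) refl l x ⟩
        l + x + x + x     ≤⟨ |L|+3x≤4t ⟩
        4 * t             ≡⟨ sym r+1≡4t ⟩
        suc r             ∎)

      conclude : ∀ h → (∀ c → w h c ∉ L c) → Empty.⊥
      conclude h h∉ = <⇒≱ r<4t (begin
        4 * t                                 ≡⟨ solve 1 (λ t → con 4 :* t := t :+ t :+ t :+ t) refl t ⟩
        t + t + t + t                         ≤⟨ +-mono-≤ (+-mono-≤ (+-mono-≤ (inter h e) (inter h f)) (inter h g)) (inter e f) ⟩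
        agr h e + agr h f + agr h g + agr e f ≡⟨ sym (∑-distrib₄ _ _ _ (λ c → ⟦ same e f c ⟧)) ⟩
        _                                     ≤⟨ sum-mono-≤ pointwise ⟩
        sum {r} (λ _ → 1)                     ≡⟨ sum-1 r ⟩
        r                                     ∎)
        where
        -- Where `e` and `f` agree the last term already uses up the 1, so `h` must avoid all three
        -- words there. Elsewhere shared values are blocked, so `h` agrees with at most one of them.
        pointwise : ∀ c → ⟦ same h e c ⟧ + ⟦ same h f c ⟧ + ⟦ same h g c ⟧ + ⟦ same e f c ⟧ ≤ 1
        pointwise c
          with w e c ≈? w f c | w e c ≈? w g c | w f c ≈? w g c | h∉ c
             | w h c ≈? w e c | w h c ≈? w f c | w h c ≈? w g c
        ... | yes _   | yes _   | _       | h∉ | yes h≡e | _       | _       = contradiction (here h≡e) h∉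
        ... | yes e≡f | yes _   | _       | _  | no  h≢e | yes h≡f | _       = contradiction (trans h≡f (sym e≡f)) h≢e
        ... | yes _   | yes e≡g | _       | _  | no  h≢e | no  _   | yes h≡g = contradiction (trans h≡g (sym e≡g)) h≢e
        ... | yes _   | yes _   | _       | _  | no  _   | no  _   | no  _   = ≤-refl
        ... | yes _   | no  _   | _       | h∉ | yes h≡e | _       | _       = contradiction (here h≡e) h∉
        ... | yes e≡f | no  _   | _       | _  | no  h≢e | yes h≡f | _       = contradiction (trans h≡f (sym e≡f)) h≢e
        ... | yes _   | no  _   | _       | h∉ | no  _   | no  _   | yes h≡g = contradiction (there (here h≡g)) h∉
        ... | yes _   | no  _   | _       | _  | no  _   | no  _   | no  _   = ≤-refl
        ... | no  _   | yes _   | _       | h∉ | yes h≡e | _       | _       = contradiction (here h≡e) h∉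
        ... | no  _   | yes e≡g | _       | _  | no  h≢e | _       | yes h≡g = contradiction (trans h≡g (sym e≡g)) h≢e
        ... | no  _   | yes _   | _       | _  | no  _   | yes _   | no  _   = ≤-refl
        ... | no  _   | yes _   | _       | _  | no  _   | no  _   | no  _   = z≤n
        ... | no  e≢f | no  _   | _       | _  | yes h≡e | yes h≡f | _       = contradiction (trans (sym h≡e) h≡f) e≢f
        ... | no  _   | no  e≢g | _       | _  | yes h≡e | no  _   | yes h≡g = contradiction (trans (sym h≡e) h≡g) e≢g
        ... | no  _   | no  _   | _       | _  | yes _   | no  _   | no  _   = ≤-refl
        ... | no  _   | no  _   | yes _   | h∉ | no  _   | yes h≡f | _       = contradiction (here h≡f) h∉
        ... | no  _   | no  _   | no  f≢g | _  | no  _   | yes h≡f | yes h≡g = contradiction (trans (sym h≡f) h≡g) f≢g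
        ... | no  _   | no  _   | no  _   | _  | no  _   | yes _   | no  _   = ≤-refl
        ... | no  _   | no  _   | _       | _  | no  _   | no  _   | yes _   = ≤-refl
        ... | no  _   | no  _   | _       | _  | no  _   | no  _   | no  _   = z≤n

    -- The words realising `S` and `S′` agree with `e` in `t` columns each. They differ from each
    -- other: in a column where `f` agrees with both `e` and `g`, all three agree, so
    -- `agr f g + t ≤ r + x < r + t`. The dichotomy then makes `agr f g` equal to `t`.
    ¬large-overlap : ∀ e (S S′ : Fin r → Bool) → count S ≡ t → count S′ ≡ t →
               let x = count (λ c → S c ∧ S′ c) in x < t → ¬ t < x + x + x
    ¬large-overlap e S S′ |S| |S′| x<t t<3x with realise e S |S| | realise e S′ |S′|
    ... | f , f~S | g , g~S′ = ¬large-triple e f g ef eg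
      (proj₁ (agr-dichotomy f g fg<r)) (proj₂ (agr-dichotomy e f (subst (_< r) (sym ef) t<r)))
      (subst (λ x → t < x + x + x) (sym X≡) t<3x)
      where
      open ≤-Reasoning
      ef : agr e f ≡ t
      ef = trans (sum-cong-≗ (cong ⟦_⟧ ∘ f~S)) |S|

      eg : agr e g ≡ t
      eg = trans (sum-cong-≗ (cong ⟦_⟧ ∘ g~S′)) |S′|

      x : ℕ
      x = count (λ c → S c ∧ S′ c)

      X≡ : count (λ c → same e f c ∧ same e g c) ≡ x
      X≡ = sum-cong-≗ (λ c → cong ⟦_⟧ (cong₂ _∧_ (f~S c) (g~S′ c)))

      pointwise : ∀ c → ⟦ same f g c ⟧ + ⟦ same e f c ⟧ ≤ 1 + ⟦ same e f c ∧ same e g c ⟧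
      pointwise c with w f c ≈? w g c | w e c ≈? w f c | w e c ≈? w g c
      ... | yes _   | yes _   | yes _   = ≤-refl
      ... | yes f≡g | yes e≡f | no  e≢g = contradiction (trans e≡f f≡g) e≢g
      ... | yes _   | no  _   | _       = ≤-refl
      ... | no  _   | yes _   | _       = s≤s z≤n
      ... | no  _   | no  _   | _       = z≤n

      fg<r : agr f g < r
      fg<r = +-cancelʳ-< x (agr f g) r (begin-strict
        agr f g + x       <⟨ +-monoʳ-< (agr f g) x<t ⟩
        agr f g + t       ≡⟨ cong (agr f g +_) (sym ef) ⟩
        agr f g + agr e f ≡⟨ sym (∑-distrib-+ _ (λ c → ⟦ same e f c ⟧)) ⟩
        _                 ≤⟨ sum-mono-≤ pointwise ⟩
        _                 ≡⟨ ∑-distrib-+ (λ _ → 1) (λ c → ⟦ same e f c ∧ same e g c ⟧) ⟩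
        sum {r} (λ _ → 1) + count (λ c → same e f c ∧ same e g c) ≡⟨ cong₂ _+_ (sum-1 r) X≡ ⟩
        r + x             ∎)

-- A single word already leads to a contradiction. The bound `t < r` provides exactly the columns
-- needed for two `t`-sets that share `t ∸ 1` of them.
¬uncoverable : {V E : Set} (_≈?_ : DecidableEquality V) (w : E → Fin r → V) →
  let open Words _≈?_ w in
  ∀ t → r < 4 * t → t < r → (∀ i j → t ≤ agr i j) →
  (∀ (L : Fin r → List V) → sum (length ∘ L) + t ≤ r → ∃ λ i → ∀ c → w i c ∉ L c) →
  ¬ E
¬uncoverable {r} _≈?_ w (suc k) r<4t t<r inter miss e with almost-equal-sets k t<r
... | S , S′ , |S| , |S′| , |S∩S′| = conclude k refl
  where
  open Words _≈?_ w
  open NoCover (suc k) r<4t t<r inter miss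

  r+1≡4t : suc r ≡ 4 * suc k
  r+1≡4t =
    let f , f~S = realise e S |S| in
    proj₂ (agr-dichotomy e f (subst (_< r) (sym (trans (sum-cong-≗ (cong ⟦_⟧ ∘ f~S)) |S|)) t<r))

  conclude : ∀ k′ → k ≡ k′ → Empty.⊥
  -- For `t = 1` the two sets are disjoint and the overlap argument is void, but `suc r ≡ 4 * t`
  -- leaves only `r = 3`.
  conclude zero refl with refl ← r+1≡4t =
    three-columns w
      (λ i j → let c , eq = count-positive (same i j) (inter i j) in c , same⇒≡ i j c eq)
      (λ L |L|≤2 → miss L (≤-trans (+-monoˡ-≤ 1 |L|≤2) ≤-refl)) e
  -- With overlap `t ∸ 1`, three times the overlap exceeds `t` as soon as `t` is at least 2.
  conclude (suc k′) refl = ¬large-overlap e S S′ |S| |S′|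
    (subst (_< suc k) (sym |S∩S′|) ≤-refl)
    (subst (λ x → suc k < x + x + x) (sym |S∩S′|)
      (s≤s (+-monoˡ-≤ (suc k′) (≤-trans (s≤s z≤n) (m≤n+m (suc k′) k′)))))

-- Vertex sets collected from lists.

∣p∪q∣≤∣p∣+∣q∣ : ∀ {n} (p q : Subset n) → ∣ p ∪ q ∣ ≤ ∣ p ∣ + ∣ q ∣
∣p∪q∣≤∣p∣+∣q∣ []            []            = z≤n
∣p∪q∣≤∣p∣+∣q∣ (outside ∷ p) (outside ∷ q) = ∣p∪q∣≤∣p∣+∣q∣ p q
∣p∪q∣≤∣p∣+∣q∣ (outside ∷ p) (inside  ∷ q) =
  ≤-trans (s≤s (∣p∪q∣≤∣p∣+∣q∣ p q)) (≤-reflexive (sym (+-suc ∣ p ∣ ∣ q ∣)))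
∣p∪q∣≤∣p∣+∣q∣ (inside  ∷ p) (outside ∷ q) = s≤s (∣p∪q∣≤∣p∣+∣q∣ p q)
∣p∪q∣≤∣p∣+∣q∣ (inside  ∷ p) (inside  ∷ q) =
  s≤s (≤-trans (∣p∪q∣≤∣p∣+∣q∣ p q) (+-monoʳ-≤ ∣ p ∣ (n≤1+n ∣ q ∣)))

fromList : ∀ {n} → List (Fin n) → Subset n
fromList = ⋃ ∘ List.map ⁅_⁆

∣fromList∣≤length : ∀ {n} (xs : List (Fin n)) → ∣ fromList xs ∣ ≤ length xs
∣fromList∣≤length {n} []   = ≤-reflexive (∣⊥∣≡0 n)
∣fromList∣≤length (x ∷ xs) = ≤-trans (∣p∪q∣≤∣p∣+∣q∣ ⁅ x ⁆ (fromList xs))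
  (+-mono-≤ (≤-reflexive (∣⁅x⁆∣≡1 x)) (∣fromList∣≤length xs))

∈-fromList⁺ : ∀ {n} {v : Fin n} {xs} → v ∈ₗ xs → v ∈ fromList xs
∈-fromList⁺ (here refl) = x∈p∪q⁺ (inj₁ (x∈⁅x⁆ _))
∈-fromList⁺ (there v∈)  = x∈p∪q⁺ (inj₂ (∈-fromList⁺ v∈))

fromColumns : ∀ {n} → (Fin r → List (Fin n)) → Subset n
fromColumns L = fromList (List.concat (List.tabulate L))

∣fromColumns∣≤ : ∀ {n} (L : Fin r → List (Fin n)) → ∣ fromColumns L ∣ ≤ sum (length ∘ L)
∣fromColumns∣≤ L = ≤-trans (∣fromList∣≤length (List.concat (List.tabulate L))) (≤-reflexive (length-concat L))
  where
  length-concat : ∀ {r} {A : Set} (L : Fin r → List A) →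
                  length (List.concat (List.tabulate L)) ≡ sum (length ∘ L)
  length-concat {zero}  L = refl
  length-concat {suc r} L = trans (length-++ (L zero)) (cong (length (L zero) +_) (length-concat (L ∘ suc)))

∈-fromColumns⁺ : ∀ {n} {v : Fin n} (L : Fin r → List (Fin n)) c → v ∈ₗ L c → v ∈ fromColumns L
∈-fromColumns⁺ L c v∈ = ∈-fromList⁺ (∈-concat⁺′ v∈ (∈-tabulate⁺ c))

-- From hyperedges to words.

∣p∣≤columns : ∀ {n} {p : Subset n} (L : Fin r → List (Fin n)) (cls : Fin n → Fin r) →
              (∀ v → v ∈ p → v ∈ₗ L (cls v)) → ∣ p ∣ ≤ sum (length ∘ L)
∣p∣≤columns L cls p⊆L = ≤-trans
  (p⊆q⇒∣p∣≤∣q∣ (λ {v} v∈p → ∈-fromColumns⁺ L (cls v) (p⊆L v v∈p))) (∣fromColumns∣≤ L)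

-- Pigeonhole: list for each class at most one vertex of `p`. The lists contain all of `p`, so their
-- total is at least `r`, and none of the `r` lists can be empty.
transversal : ∀ {n} (p : Subset n) (cls : Fin n → Fin r) → r ≤ ∣ p ∣ →
              (∀ u v → u ∈ p → v ∈ p → cls u ≡ cls v → u ≡ v) →
              ∀ c → ∃ λ v → v ∈ p × cls v ≡ c
transversal {r} {n} p cls r≤∣p∣ cls-inj c =
  nonempty c (sum-mono-≤-tight length≤1
    (≤-trans (≤-reflexive (sum-1 r)) (≤-trans r≤∣p∣ (∣p∣≤columns column cls p⊆column))) c)
  where
  member? : ∀ c → Dec (∃ λ v → v ∈ p × cls v ≡ c)
  member? c = any? (λ v → (v ∈? p) ×-dec (cls v ≟ c))

  column : Fin r → List (Fin n)
  column c with member? c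
  ... | yes (v , _) = v ∷ []
  ... | no  _       = []

  length≤1 : ∀ c → length (column c) ≤ 1
  length≤1 c with member? c
  ... | yes _ = ≤-refl
  ... | no  _ = z≤n

  nonempty : ∀ c → 1 ≤ length (column c) → ∃ λ v → v ∈ p × cls v ≡ c
  nonempty c 1≤ with yes v ← member? c = v

  p⊆column : ∀ v → v ∈ p → v ∈ₗ column (cls v)
  p⊆column v v∈p with member? (cls v)
  ... | yes (u , u∈p , eq) = here (cls-inj v u v∈p u∈p (sym eq))
  ... | no  ∄             = contradiction (v , v∈p , refl) ∄

-- At `r = 0` truncated subtraction would allow `t = 0`; the bound `r < 4 * t` excludes this.
t≤r∸1⇒t<r : ∀ r t → r < 4 * t → t ≤ r ∸ 1 → t < r
t≤r∸1⇒t<r zero    zero ()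
t≤r∸1⇒t<r (suc r) t    _ t≤r = s≤s t≤r

theorem2 : (r t : ℕ) → r < 4 * t → t ≤ r ∸ 1 →
    (H : Hypergraph) → Uniform r H → Partite r H → Intersecting t H →
    τ≤ H (r ∸ t)
theorem2 r t r<4t t≤r∸1 H uniform (cls , _ , cls-inj) intersecting =
  -- Existence of a small cover is decidable, so assume there is none. Then there is no hyperedge at
  -- all, and the empty set is a cover.
  decidable-stable (anySubset? (λ T → isCover? T ×-dec (∣ T ∣ ≤? r ∸ t))) λ ∄cover →
    ∄cover (⊥ , (λ i → contradiction i (¬uncoverable _≟_ w t r<4t t<r inter (miss ∄cover))) ,
                 ≤-trans (≤-reflexive (∣⊥∣≡0 (n H))) z≤n)
  where
  Covers : Subset (n H) → Edge H → Set
  Covers T i = ∃ λ v → v ∈ T × v ∈ edge H i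

  covers? : ∀ T i → Dec (Covers T i)
  covers? T i = any? (λ v → (v ∈? T) ×-dec (v ∈? edge H i))

  isCover? : ∀ T → Dec (IsCover H T)
  isCover? T = all? (covers? T)

  t<r : t < r
  t<r = t≤r∸1⇒t<r r t r<4t t≤r∸1

  vertex : ∀ i c → ∃ λ v → v ∈ edge H i × cls v ≡ c
  vertex i = transversal (edge H i) cls (≤-reflexive (sym (uniform i))) (cls-inj i)

  w : Edge H → Fin r → Fin (n H)
  w i c = proj₁ (vertex i c)

  w∈ : ∀ i c → w i c ∈ edge H i
  w∈ i c = proj₁ (proj₂ (vertex i c))

  w-unique : ∀ i v → v ∈ edge H i → v ≡ w i (cls v)
  w-unique i v v∈ = cls-inj i v _ v∈ (w∈ i (cls v)) (sym (proj₂ (proj₂ (vertex i (cls v)))))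

  open Words _≟_ w

  -- A shared vertex is the letter of both words in the column of its class, so one vertex per
  -- column of agreement accounts for the whole intersection.
  ∣∩∣≤agr : ∀ i j → ∣ edge H i ∩ edge H j ∣ ≤ agr i j
  ∣∩∣≤agr i j = ≤-trans (∣p∣≤columns common cls common-complete)
                         (≤-reflexive (sum-cong-≗ length-common))
    where
    common : Fin r → List (Fin (n H))
    common c = if same i j c then w i c ∷ [] else []

    length-common : ∀ c → length (common c) ≡ ⟦ same i j c ⟧
    length-common c with same i j c
    ... | true  = refl
    ... | false = refl

    common-complete : ∀ v → v ∈ edge H i ∩ edge H j → v ∈ₗ common (cls v)
    common-complete v v∈ with x∈p∩q⁻ (edge H i) (edge H j) v∈ | w i (cls v) ≟ w j (cls v)
    ... | v∈i , _   | yes _ = here (w-unique i v v∈i)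
    ... | v∈i , v∈j | no  ≢ = contradiction (trans (sym (w-unique i v v∈i)) (w-unique j v v∈j)) ≢

  inter : ∀ i j → t ≤ agr i j
  inter i j with i ≟ j
  ... | no  i≢j  = ≤-trans (intersecting i j i≢j) (∣∩∣≤agr i j)
  -- `Intersecting` only compares distinct positions; on the diagonal the edge has `r` vertices,
  -- more than `t`.
  ... | yes refl = begin
    t                       ≤⟨ <⇒≤ t<r ⟩
    r                       ≡⟨ sym (uniform i) ⟩
    ∣ edge H i ∣            ≡⟨ cong ∣_∣ (sym (∩-idem (edge H i))) ⟩
    ∣ edge H i ∩ edge H i ∣ ≤⟨ ∣∩∣≤agr i i ⟩
    agr i i                 ∎
    where open ≤-Reasoning

  -- The listed vertices form a set within the budget, hence not a cover; since meeting an edge is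
  -- decidable, an edge disjoint from the set can be found.
  miss : ¬ τ≤ H (r ∸ t) → ∀ (L : Fin r → List (Fin (n H))) → sum (length ∘ L) + t ≤ r →
         ∃ λ i → ∀ c → w i c ∉ L c
  miss ∄cover L |L|+t≤r =
    let i , ¬covers = ¬∀⟶∃¬ _ (Covers (fromColumns L)) (covers? (fromColumns L)) λ cover →
          ∄cover (fromColumns L , cover , ≤-trans (∣fromColumns∣≤ L) (m+n≤o⇒m≤o∸n _ |L|+t≤r))
    in i , λ c w∈L → ¬covers (w i c , ∈-fromColumns⁺ L c w∈L , w∈ i c)
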